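{- For every cubic graph $G$ that contains a perfect matching, $\nu_2(G) \geq \frac{20}{21}\cdot \frac{|V(G)| + 2\cdot \nu_3(G)}{4}$.
   Context: Graphs are finite, without loops, possibly with multiple edges; a graph is cubic if every vertex has degree $3$. For $k\geq 1$, $\nu_k(G)$ is the maximum number of edges of a $k$-edge-colorable subgraph of $G$. -}

module Defs where

open import Data.Nat.Base using (ℕ; zero; suc; _≤_; s≤s⁻¹; NonZero)
open import Data.Nat.Properties as ℕ using (≤∧≢⇒<)
open import Data.Fin.Base using (Fin; zero; finToFun; funToFin)
open import Data.Fin.Properties as Fin using (all?; any?; finToFun-funToFin)
open import Data.Fin.Subset using (Subset; _∈_; ∣_∣; ⊥)
open import Data.Fin.Subset.Properties using (_∈?_; anySubset?; ∣p∣≤n; ∉⊥; ∣⊥∣≡0)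
open import Data.List.Base using (length; filter; allFin)
open import Data.Product.Base using (∃-syntax; _×_; _,_)
open import Data.Sum.Base using (_⊎_)
open import Function.Base using (_∘_)
open import Level using (Level)
open import Relation.Nullary using (¬_; Dec; yes; no; contradiction)
open import Relation.Nullary.Decidable using (map′; _×-dec_; _⊎-dec_; _→-dec_; ¬?)
open import Relation.Unary using (Pred; Decidable)
open import Relation.Binary.PropositionalEquality using (_≡_; _≢_; refl; subst₂)

private
  variable
    ℓ : Level

-- Parallel edges are allowed. The order of the two endpoints of an edge carries
-- no meaning: edges are only ever used through _∋_ below, which is symmetric
-- in the endpoints.
record Graph : Set where
  field
    |V| |E|   : ℕ
    end₁ end₂ : Fin |E| → Fin |V|
    loopless  : ∀ e → end₁ e ≢ end₂ e

  Vertex Edge : Set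
  Vertex = Fin |V|
  Edge   = Fin |E|

  infix 4 _∋_ _∋?_

  _∋_ : Edge → Vertex → Set
  e ∋ v = end₁ e ≡ v ⊎ end₂ e ≡ v

  _∋?_ : ∀ e v → Dec (e ∋ v)
  e ∋? v = (end₁ e Fin.≟ v) ⊎-dec (end₂ e Fin.≟ v)

  -- Correct as a degree because there are no loops, which would count twice.
  degree : Vertex → ℕ
  degree v = length (filter (_∋? v) (allFin |E|))

  Cubic : Set
  Cubic = ∀ v → degree v ≡ 3

  Adjacent : Edge → Edge → Set
  Adjacent e f = e ≢ f × ∃[ v ] (e ∋ v × f ∋ v)

  adjacent? : ∀ e f → Dec (Adjacent e f)
  adjacent? e f = ¬? (e Fin.≟ f) ×-dec any? (λ v → (e ∋? v) ×-dec (f ∋? v))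

  IsMatching : Subset |E| → Set
  IsMatching M = ∀ e f → e ∈ M → f ∈ M → ¬ Adjacent e f

  IsPerfectMatching : Subset |E| → Set
  IsPerfectMatching M = IsMatching M × (∀ v → ∃[ e ] (e ∈ M × e ∋ v))

  -- Subgraphs are represented by their edge sets, since neither colorability
  -- nor the number of edges depends on which isolated vertices are kept.
  -- The values of c outside H are irrelevant.
  IsProperOn : ∀ {k} → Subset |E| → (Edge → Fin k) → Set
  IsProperOn H c = ∀ e f → e ∈ H → f ∈ H → Adjacent e f → c e ≢ c f

  EdgeColorable : ℕ → Subset |E| → Set
  EdgeColorable k H = ∃[ c ] IsProperOn {k} H c

  isProperOn? : ∀ {k} H (c : Edge → Fin k) → Dec (IsProperOn H c)
  isProperOn? H c = all? λ e → all? λ f →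
    (e ∈? H) →-dec (f ∈? H) →-dec adjacent? e f →-dec ¬? (c e Fin.≟ c f)

  edgeColorable? : ∀ k H → Dec (EdgeColorable k H)
  edgeColorable? k H = map′
    (λ (i , p) → finToFun i , p)
    (λ (c , p) → funToFin c , λ e f e∈H f∈H e~f →
      p e f e∈H f∈H e~f
        ∘ subst₂ _≡_ (finToFun-funToFin c e) (finToFun-funToFin c f))
    (any? (isProperOn? H ∘ finToFun))

  HasColorableSubgraphOfSize : ℕ → ℕ → Set
  HasColorableSubgraphOfSize k m = ∃[ H ] (EdgeColorable k H × ∣ H ∣ ≡ m)

  hasColorableSubgraphOfSize? : ∀ k → Decidable (HasColorableSubgraphOfSize k)
  hasColorableSubgraphOfSize? k m =
    anySubset? λ H → edgeColorable? k H ×-dec (∣ H ∣ ℕ.≟ m)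

HasPerfectMatching : Graph → Set
HasPerfectMatching G = ∃[ M ] Graph.IsPerfectMatching G M

-- The largest m ≤ n satisfying P, and 0 if there is none.
largest : {P : Pred ℕ ℓ} → Decidable P → ℕ → ℕ
largest P? zero    = zero
largest P? (suc n) with P? (suc n)
... | yes _ = suc n
... | no  _ = largest P? n

largest-satisfies : {P : Pred ℕ ℓ} (P? : Decidable P) → P 0 → ∀ n → P (largest P? n)
largest-satisfies P? p₀ zero    = p₀
largest-satisfies P? p₀ (suc n) with P? (suc n)
... | yes p = p
... | no  _ = largest-satisfies P? p₀ n

largest-upper : {P : Pred ℕ ℓ} (P? : Decidable P) →
                ∀ n {m} → m ≤ n → P m → m ≤ largest P? n
largest-upper P? zero    m≤n p = m≤n
largest-upper P? (suc n) {m} m≤n p with P? (suc n)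
... | yes _ = m≤n
... | no ¬p = largest-upper P? n (s≤s⁻¹ (≤∧≢⇒< m≤n λ { refl → ¬p p })) p

ν : ℕ → Graph → ℕ
ν k G = largest (hasColorableSubgraphOfSize? k) |E|
  where open Graph G

module _ (k : ℕ) (G : Graph) where
  open Graph G

  ν-attained : .{{NonZero k}} → ∃[ H ] (EdgeColorable k H × ∣ H ∣ ≡ ν k G)
  ν-attained = largest-satisfies (hasColorableSubgraphOfSize? k) (empty k) |E|
    where
    empty : ∀ k → .{{NonZero k}} → HasColorableSubgraphOfSize k 0
    empty (suc _) =
      ⊥ , ((λ _ → zero) , λ _ _ e∈⊥ → contradiction e∈⊥ ∉⊥) , ∣⊥∣≡0 |E|

  ν-maximum : ∀ H → EdgeColorable k H → ∣ H ∣ ≤ ν k G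
  ν-maximum H col =
    largest-upper (hasColorableSubgraphOfSize? k) |E| (∣p∣≤n H) (H , col , refl)

{-# OPTIONS --safe #-}

-- Two lower bounds on ν₂ are combined. Dropping the smallest colour class of a
-- largest 3-edge-colorable subgraph gives 3 ν₂ ≥ 2 ν₃. If M is a perfect
-- matching and N a maximal matching of the complement F of M, then M ∪ N is
-- 2-edge-colorable; since F is 2-regular, every edge of N meets at most three
-- edges of F (itself included), so 3 |N| ≥ |F| = |V| and
-- 6 ν₂ ≥ 6 (|M| + |N|) ≥ 5 |V|. Hence 21 ν₂ ≥ 5 (|V| + 2 ν₃).
module Submission where

open import Defs
open import Data.Nat.Base as ℕ using (ℕ)
open import Data.Integer.Base using (+_)
open import Data.Rational.Base using (_/_; _*_; _≥_)

open import Data.Bool.Base using (if_then_else_; true; false)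
open import Data.Fin.Base using (Fin; zero; suc; punchOut)
open import Data.Fin.Properties as Fin using (any?; punchOut-injective)
open import Data.Fin.Subset using (Subset; _∈_; _∉_; _⊆_; ∣_∣; ⁅_⁆; _∪_; ∁; ⊥; inside; outside)
open import Data.Fin.Subset.Properties
  using (_∈?_; ∉⊥; x∈p∪q⁻; p⊆p∪q; q⊆p∪q; x∈⁅x⁆; x∈⁅y⁆⇒x≡y; x∈∁p⇒x∉p; x∉p⇒x∈∁p)
import Data.Integer.Base as ℤ
import Data.Integer.Properties as ℤ
open import Data.List.Base as List using (List; []; _∷_; length; filter; allFin)
import Data.List.Membership.Propositional as List
open import Data.List.Membership.Propositional.Properties using (∈-allFin)
open import Data.List.Relation.Unary.Any using (here; there)
open import Data.Nat.Base using (_+_; _≤_; z≤n) renaming (_*_ to _·_; suc to 1+)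
open import Data.Nat.Properties
open import Data.Nat.Tactic.RingSolver using (solve-∀)
open import Data.Product.Base using (∃-syntax; _×_; _,_; proj₁)
import Data.Rational.Properties as ℚ
open import Data.Rational.Base using (toℚᵘ)
open import Data.Rational.Unnormalised.Base as ℚᵘ using (mkℚᵘ)
import Data.Rational.Unnormalised.Properties as ℚᵘ
open import Data.Sum.Base using (_⊎_; inj₁; inj₂; [_,_]′)
open import Data.Vec.Base using ([]; _∷_; tabulate)
open import Data.Vec.Properties using (lookup∘tabulate; lookup⇒[]=; []=⇒lookup)
open import Function.Base using (_∘_; id)
open import Level using (Level)
open import Relation.Binary.PropositionalEquality
  using (_≡_; _≢_; refl; sym; trans; cong; cong₂; subst; subst₂; module ≡-Reasoning)
open import Relation.Nullary using (¬_; Dec; yes; no; does; contradiction)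
open import Relation.Nullary.Decidable using (dec-true; dec-false; ¬?; _×-dec_)
open import Relation.Unary using (Pred; Decidable)

open import Algebra.Properties.Semiring.Sum +-*-semiring
  using (sum; sum-syntax; sum-cong-≗; ∑-distrib-+; ∑-comm; *-distribˡ-sum; *-distribʳ-sum)

private
  variable
    a : Level
    A : Set a
    n : ℕ

-- Indicators of decidable statements and finite sums

⟦_⟧ : Dec A → ℕ
⟦ A? ⟧ = if does A? then 1 else 0

⟦⟧-yes : (A? : Dec A) → A → ⟦ A? ⟧ ≡ 1
⟦⟧-yes A? x = cong (if_then 1 else 0) (dec-true A? x)

⟦⟧-no : (A? : Dec A) → ¬ A → ⟦ A? ⟧ ≡ 0
⟦⟧-no A? ¬x = cong (if_then 1 else 0) (dec-false A? ¬x)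

sum-mono-≤ : {f g : Fin n → ℕ} → (∀ i → f i ≤ g i) → sum f ≤ sum g
sum-mono-≤ {n = ℕ.zero}  f≤g = z≤n
sum-mono-≤ {n = ℕ.suc _} f≤g = +-mono-≤ (f≤g zero) (sum-mono-≤ (f≤g ∘ suc))

sum-const : ∀ n c → ∑[ i < n ] c ≡ n · c
sum-const ℕ.zero    c = refl
sum-const (ℕ.suc n) c = cong (_+_ c) (sum-const n c)

sum-zero : ∀ n → ∑[ i < n ] 0 ≡ 0
sum-zero n = trans (sum-const n 0) (*-zeroʳ n)

-- All terms but the one at `j` vanish. This turns a value at an endpoint or at a colour into a sum,
-- so that double counting applies.
sum-δ : (g : Fin n → ℕ) (j : Fin n) → ∑[ i < n ] (g i · ⟦ j Fin.≟ i ⟧) ≡ g j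
sum-δ {n = ℕ.suc n} g zero = begin
  g zero · 1 + ∑[ i < n ] (g (suc i) · 0)
    ≡⟨ cong₂ _+_ (*-identityʳ _) (trans (sum-cong-≗ (*-zeroʳ ∘ g ∘ suc)) (sum-zero n)) ⟩
  g zero + 0  ≡⟨ +-identityʳ _ ⟩
  g zero      ∎
  where open ≡-Reasoning
sum-δ {n = ℕ.suc n} g (suc j) = cong₂ _+_ (*-zeroʳ (g zero)) (sum-δ (g ∘ suc) j)

∣p∣≡sum : (p : Subset n) → ∣ p ∣ ≡ ∑[ x < n ] ⟦ x ∈? p ⟧
∣p∣≡sum []            = refl
∣p∣≡sum (inside  ∷ p) = cong 1+ (∣p∣≡sum p)
∣p∣≡sum (outside ∷ p) = ∣p∣≡sum p

length-filter-tabulate : {P : Pred A a} (P? : Decidable P) (f : Fin n → A) →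
  length (filter P? (List.tabulate f)) ≡ ∑[ i < n ] ⟦ P? (f i) ⟧
length-filter-tabulate {n = ℕ.zero}  P? f = refl
length-filter-tabulate {n = ℕ.suc _} P? f with does (P? (f zero))
... | true  = cong 1+ (length-filter-tabulate P? (f ∘ suc))
... | false = length-filter-tabulate P? (f ∘ suc)

-- Subsets cut out by a decidable predicate

select : {P : Pred (Fin n) a} → Decidable P → Subset n
select P? = tabulate (does ∘ P?)

module _ {P : Pred (Fin n) a} (P? : Decidable P) where

  ∈-select⁺ : ∀ {x} → P x → x ∈ select P?
  ∈-select⁺ {x} px =
    lookup⇒[]= x _ (trans (lookup∘tabulate (does ∘ P?) x) (dec-true (P? x) px))

  ∈-select⁻ : ∀ {x} → x ∈ select P? → P x
  ∈-select⁻ {x} x∈ with P? x | trans (sym (lookup∘tabulate (does ∘ P?) x)) ([]=⇒lookup x∈)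
  -- In the `no` case the second scrutinee would prove `false ≡ true`.
  ... | yes px | _ = px

-- Incidences and weighted double counting

module _ (G : Graph) where
  open Graph G

  inc : Edge → Vertex → ℕ
  inc e v = ⟦ e ∋? v ⟧

  -- The two sides could differ only at a loop, where the right side would be 2; `loopless` excludes
  -- this.
  inc-ends : ∀ e v → inc e v ≡ ⟦ end₁ e Fin.≟ v ⟧ + ⟦ end₂ e Fin.≟ v ⟧
  inc-ends e v with end₁ e Fin.≟ v | end₂ e Fin.≟ v
  ... | yes refl | yes q = contradiction (sym q) (loopless e)
  ... | yes _    | no  _ = refl
  ... | no  _    | yes _ = refl
  ... | no  _    | no  _ = refl

  ∑-inc : ∀ (g : Vertex → ℕ) e → ∑[ v < |V| ] (g v · inc e v) ≡ g (end₁ e) + g (end₂ e)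
  ∑-inc g e = begin
    ∑[ v < |V| ] (g v · inc e v)
      ≡⟨ sum-cong-≗ (λ v → trans (cong (g v ·_) (inc-ends e v)) (*-distribˡ-+ (g v) _ _)) ⟩
    ∑[ v < |V| ] (g v · ⟦ end₁ e Fin.≟ v ⟧ + g v · ⟦ end₂ e Fin.≟ v ⟧)
      ≡⟨ ∑-distrib-+ (λ v → g v · ⟦ end₁ e Fin.≟ v ⟧) (λ v → g v · ⟦ end₂ e Fin.≟ v ⟧) ⟩
    ∑[ v < |V| ] (g v · ⟦ end₁ e Fin.≟ v ⟧) + ∑[ v < |V| ] (g v · ⟦ end₂ e Fin.≟ v ⟧)
      ≡⟨ cong₂ _+_ (sum-δ g (end₁ e)) (sum-δ g (end₂ e)) ⟩
    g (end₁ e) + g (end₂ e)  ∎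
    where open ≡-Reasoning

  weightedDegree : (Edge → ℕ) → Vertex → ℕ
  weightedDegree w v = ∑[ e < |E| ] (w e · inc e v)

  -- Both sides sum `w e · g v` over all incident pairs of an edge and a vertex. Constant `g` gives
  -- the usual handshake lemma; `g = degreeIn N` serves to bound maximal matchings.
  handshake : (w : Edge → ℕ) (g : Vertex → ℕ) →
    ∑[ e < |E| ] (w e · (g (end₁ e) + g (end₂ e))) ≡ ∑[ v < |V| ] (g v · weightedDegree w v)
  handshake w g = begin
    ∑[ e < |E| ] (w e · (g (end₁ e) + g (end₂ e)))
      ≡⟨ sum-cong-≗ (λ e → trans (cong (w e ·_) (sym (∑-inc g e))) (*-distribˡ-sum (w e) (λ v → g v · inc e v))) ⟩
    ∑[ e < |E| ] ∑[ v < |V| ] (w e · (g v · inc e v))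
      ≡⟨ ∑-comm (λ e v → w e · (g v · inc e v)) ⟩
    ∑[ v < |V| ] ∑[ e < |E| ] (w e · (g v · inc e v))
      ≡⟨ sum-cong-≗ (λ v → trans (sum-cong-≗ λ e → swap (w e) (g v) (inc e v))
                                 (sym (*-distribˡ-sum (g v) (λ e → w e · inc e v)))) ⟩
    ∑[ v < |V| ] (g v · weightedDegree w v)  ∎
    where
    open ≡-Reasoning
    swap : ∀ x y z → x · (y · z) ≡ y · (x · z)
    swap = solve-∀

  handshake₁ : (w : Edge → ℕ) → ∑[ v < |V| ] weightedDegree w v ≡ 2 · sum w
  handshake₁ w = begin
    ∑[ v < |V| ] weightedDegree w v          ≡⟨ sum-cong-≗ (λ v → sym (*-identityˡ (weightedDegree w v))) ⟩
    ∑[ v < |V| ] (1 · weightedDegree w v)    ≡⟨ sym (handshake w (λ _ → 1)) ⟩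
    ∑[ e < |E| ] (w e · 2)                   ≡⟨ sym (*-distribʳ-sum 2 w) ⟩
    sum w · 2                                ≡⟨ *-comm (sum w) 2 ⟩
    2 · sum w                                ∎
    where open ≡-Reasoning

  weightedDegree-+ : ∀ w₁ w₂ v →
    weightedDegree (λ e → w₁ e + w₂ e) v ≡ weightedDegree w₁ v + weightedDegree w₂ v
  weightedDegree-+ w₁ w₂ v =
    trans (sum-cong-≗ λ e → *-distribʳ-+ (inc e v) (w₁ e) (w₂ e))
          (∑-distrib-+ (λ e → w₁ e · inc e v) (λ e → w₂ e · inc e v))

  degree≡weightedDegree : ∀ v → degree v ≡ weightedDegree (λ _ → 1) v
  degree≡weightedDegree v =
    trans (length-filter-tabulate (_∋? v) id) (sum-cong-≗ λ e → sym (*-identityˡ (inc e v)))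

  -- Degrees within an edge set

  χ : Subset |E| → Edge → ℕ
  χ H e = ⟦ e ∈? H ⟧

  degreeIn : Subset |E| → Vertex → ℕ
  degreeIn = weightedDegree ∘ χ

  ∑-degreeIn : ∀ H → ∑[ v < |V| ] degreeIn H v ≡ 2 · ∣ H ∣
  ∑-degreeIn H = trans (handshake₁ (χ H)) (cong (2 ·_) (sym (∣p∣≡sum H)))

  -- The term of `e` alone already contributes 1: the indicator of `e`, restricted to edges at `v`,
  -- lies termwise below the summands of `degreeIn H v`.
  degreeIn≥1 : ∀ {H e v} → e ∈ H → e ∋ v → 1 ≤ degreeIn H v
  degreeIn≥1 {H} {e} {v} e∈H e∋v = begin
    1                                            ≡⟨ ⟦⟧-yes (e ∋? v) e∋v ⟨
    inc e v                                      ≡⟨ sum-δ (λ f → inc f v) e ⟨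
    ∑[ f < |E| ] (inc f v · ⟦ e Fin.≟ f ⟧)       ≤⟨ sum-mono-≤ le ⟩
    degreeIn H v                                 ∎
    where
    open ≤-Reasoning
    le : ∀ f → inc f v · ⟦ e Fin.≟ f ⟧ ≤ χ H f · inc f v
    le f with e Fin.≟ f
    ... | yes refl rewrite ⟦⟧-yes (e ∈? H) e∈H = ≤-reflexive (*-comm (inc e v) 1)
    ... | no _ = ≤-trans (≤-reflexive (*-zeroʳ (inc f v))) z≤n

  χ-∁ : ∀ H e → χ (∁ H) e + χ H e ≡ 1
  χ-∁ H e with e ∈? H
  ... | yes e∈H = cong (_+ 1) (⟦⟧-no (e ∈? ∁ H) (λ e∈∁H → x∈∁p⇒x∉p e∈∁H e∈H))
  ... | no  e∉H = cong (_+ 0) (⟦⟧-yes (e ∈? ∁ H) (x∉p⇒x∈∁p e∉H))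

  ∣∁H∣+∣H∣ : ∀ H → ∣ ∁ H ∣ + ∣ H ∣ ≡ |E|
  ∣∁H∣+∣H∣ H = begin
    ∣ ∁ H ∣ + ∣ H ∣                     ≡⟨ cong₂ _+_ (∣p∣≡sum (∁ H)) (∣p∣≡sum H) ⟩
    sum (χ (∁ H)) + sum (χ H)           ≡⟨ sym (∑-distrib-+ (χ (∁ H)) (χ H)) ⟩
    ∑[ e < |E| ] (χ (∁ H) e + χ H e)    ≡⟨ sum-cong-≗ (χ-∁ H) ⟩
    ∑[ e < |E| ] 1                      ≡⟨ sum-const |E| 1 ⟩
    |E| · 1                             ≡⟨ *-identityʳ |E| ⟩
    |E|                                 ∎
    where open ≡-Reasoning

  degreeIn-∁ : ∀ H v → degreeIn (∁ H) v + degreeIn H v ≡ degree v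
  degreeIn-∁ H v = begin
    degreeIn (∁ H) v + degreeIn H v                   ≡⟨ sym (weightedDegree-+ (χ (∁ H)) (χ H) v) ⟩
    weightedDegree (λ e → χ (∁ H) e + χ H e) v        ≡⟨ sum-cong-≗ (λ e → cong (_· inc e v) (χ-∁ H e)) ⟩
    weightedDegree (λ _ → 1) v                        ≡⟨ sym (degree≡weightedDegree v) ⟩
    degree v                                          ∎
    where open ≡-Reasoning

  disjoint-∪ : ∀ M N → N ⊆ ∁ M → ∣ M ∣ + ∣ N ∣ ≤ ∣ M ∪ N ∣
  disjoint-∪ M N N⊆∁M = begin
    ∣ M ∣ + ∣ N ∣                     ≡⟨ cong₂ _+_ (∣p∣≡sum M) (∣p∣≡sum N) ⟩
    sum (χ M) + sum (χ N)             ≡⟨ sym (∑-distrib-+ (χ M) (χ N)) ⟩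
    ∑[ e < |E| ] (χ M e + χ N e)      ≤⟨ sum-mono-≤ le ⟩
    sum (χ (M ∪ N))                   ≡⟨ ∣p∣≡sum (M ∪ N) ⟨
    ∣ M ∪ N ∣                         ∎
    where
    open ≤-Reasoning
    le : ∀ e → χ M e + χ N e ≤ χ (M ∪ N) e
    le e with e ∈? M | e ∈? N
    ... | yes e∈M | yes e∈N = contradiction e∈M (x∈∁p⇒x∉p (N⊆∁M e∈N))
    ... | yes e∈M | no  _   = ≤-reflexive (sym (⟦⟧-yes (e ∈? M ∪ N) (p⊆p∪q N e∈M)))
    ... | no  _   | yes e∈N = ≤-reflexive (sym (⟦⟧-yes (e ∈? M ∪ N) (q⊆p∪q M N e∈N)))
    ... | no  _   | no  _   = z≤n

  -- Maximal matchings and their size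

  Adjacent-sym : ∀ {e f} → Adjacent e f → Adjacent f e
  Adjacent-sym (e≢f , v , e∋v , f∋v) = e≢f ∘ sym , v , f∋v , e∋v

  -- The first alternative is separate because `Adjacent` is irreflexive.
  Dominated : Subset |E| → Edge → Set
  Dominated N e = e ∈ N ⊎ ∃[ f ] (f ∈ N × Adjacent e f)

  IsMaximalMatchingIn : Subset |E| → Subset |E| → Set
  IsMaximalMatchingIn F N = N ⊆ F × IsMatching N × (∀ e → e ∈ F → Dominated N e)

  insert-matching : ∀ {N e} → IsMatching N → (∀ f → f ∈ N → ¬ Adjacent e f) →
                    IsMatching (N ∪ ⁅ e ⁆)
  insert-matching {N} {e} N-matching e-free f g f∈ g∈ f~g
    with x∈p∪q⁻ N ⁅ e ⁆ f∈ | x∈p∪q⁻ N ⁅ e ⁆ g∈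
  ... | inj₁ f∈N | inj₁ g∈N = N-matching f g f∈N g∈N f~g
  ... | inj₁ f∈N | inj₂ g∈e rewrite x∈⁅y⁆⇒x≡y e g∈e = e-free f f∈N (Adjacent-sym f~g)
  ... | inj₂ f∈e | inj₁ g∈N rewrite x∈⁅y⁆⇒x≡y e f∈e = e-free g g∈N f~g
  ... | inj₂ f∈e | inj₂ g∈e =
    proj₁ f~g (trans (x∈⁅y⁆⇒x≡y e f∈e) (sym (x∈⁅y⁆⇒x≡y e g∈e)))

  -- An edge of `F` joins the matching built from the rest of the list exactly when no chosen edge
  -- is adjacent to it. Domination survives because the matching only grows.
  greedy : ∀ F (es : List Edge) →
    ∃[ N ] (N ⊆ F × IsMatching N × (∀ e → e ∈ F → e List.∈ es → Dominated N e))
  greedy F [] =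
    ⊥ , (λ e∈⊥ → contradiction e∈⊥ ∉⊥) , (λ _ _ e∈⊥ → contradiction e∈⊥ ∉⊥) , λ _ _ ()
  greedy F (e ∷ es) with greedy F es | e ∈? F
  ... | N , N⊆F , m , dom | no e∉F = N , N⊆F , m , λ where
    .e e∈F (here refl) → contradiction e∈F e∉F
    f f∈F (there f∈es) → dom f f∈F f∈es
  ... | N , N⊆F , m , dom | yes e∈F with any? (λ f → f ∈? N ×-dec adjacent? e f)
  ...   | yes e-dom = N , N⊆F , m , λ where
    .e _ (here refl) → inj₂ e-dom
    f f∈F (there f∈es) → dom f f∈F f∈es
  ...   | no  e-free =
    N ∪ ⁅ e ⁆
    , (λ x∈ → [ N⊆F , (λ x∈e → subst (_∈ F) (sym (x∈⁅y⁆⇒x≡y e x∈e)) e∈F) ]′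
                (x∈p∪q⁻ N ⁅ e ⁆ x∈))
    , insert-matching m (λ f f∈N e~f → e-free (f , f∈N , e~f))
    , λ where
        .e _ (here refl) → inj₁ (q⊆p∪q N ⁅ e ⁆ (x∈⁅x⁆ e))
        f f∈F (there f∈es) →
          [ inj₁ ∘ p⊆p∪q ⁅ e ⁆ , (λ (g , g∈N , f~g) → inj₂ (g , p⊆p∪q ⁅ e ⁆ g∈N , f~g)) ]′
            (dom f f∈F f∈es)

  maximalMatchingIn : ∀ F → ∃[ N ] IsMaximalMatchingIn F N
  maximalMatchingIn F with greedy F (allFin |E|)
  ... | N , N⊆F , m , dom = N , N⊆F , m , λ e e∈F → dom e e∈F (∈-allFin e)

  -- An edge of `N` covers both of its own ends; any other dominated edge shares at least one end
  -- with an edge of `N`. The extra `χ N e` is what later improves the factor 4 to 3.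
  dominated-ends : ∀ {N e} → Dominated N e →
    1 + χ N e ≤ degreeIn N (end₁ e) + degreeIn N (end₂ e)
  dominated-ends {N} {e} dom with e ∈? N | dom
  ... | yes e∈N | _ = +-mono-≤ (degreeIn≥1 e∈N (inj₁ refl)) (degreeIn≥1 e∈N (inj₂ refl))
  ... | no  e∉N | inj₁ e∈N = contradiction e∈N e∉N
  ... | no  _   | inj₂ (f , f∈N , _ , _ , inj₁ refl , f∋v) = m≤n⇒m≤n+o _ (degreeIn≥1 f∈N f∋v)
  ... | no  _   | inj₂ (f , f∈N , _ , _ , inj₂ refl , f∋v) = m≤n⇒m≤o+n _ (degreeIn≥1 f∈N f∋v)

  -- Sum `dominated-ends` over `F`. After double counting, each vertex contributes
  -- `degreeIn N v · degreeIn F v`, at most twice its `N`-degree, so the total is at most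
  -- `4 · ∣ N ∣`. The left side contains `∣ N ∣` once, and cancelling it leaves 3.
  maximalMatching-size : ∀ {F N} →
    (∀ v → degreeIn F v ≤ 2) → IsMaximalMatchingIn F N → ∣ F ∣ ≤ 3 · ∣ N ∣
  maximalMatching-size {F} {N} F≤2 (N⊆F , _ , dom) = +-cancelʳ-≤ ∣ N ∣ ∣ F ∣ (3 · ∣ N ∣) (begin
    ∣ F ∣ + ∣ N ∣                                     ≡⟨ cong₂ _+_ (∣p∣≡sum F) (∣p∣≡sum N) ⟩
    sum (χ F) + sum (χ N)                             ≡⟨ sym (∑-distrib-+ (χ F) (χ N)) ⟩
    ∑[ e < |E| ] (χ F e + χ N e)                      ≤⟨ sum-mono-≤ le ⟩
    ∑[ e < |E| ] (χ F e · (degreeIn N (end₁ e) + degreeIn N (end₂ e)))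
                                                      ≡⟨ handshake (χ F) (degreeIn N) ⟩
    ∑[ v < |V| ] (degreeIn N v · degreeIn F v)        ≤⟨ sum-mono-≤ (λ v → *-monoʳ-≤ (degreeIn N v) (F≤2 v)) ⟩
    ∑[ v < |V| ] (degreeIn N v · 2)                   ≡⟨ *-distribʳ-sum 2 (degreeIn N) ⟨
    sum (degreeIn N) · 2                              ≡⟨ cong (_· 2) (∑-degreeIn N) ⟩
    2 · ∣ N ∣ · 2                                     ≡⟨ arith ∣ N ∣ ⟩
    3 · ∣ N ∣ + ∣ N ∣                                 ∎)
    where
    open ≤-Reasoning
    arith : ∀ k → 2 · k · 2 ≡ 3 · k + k
    arith = solve-∀
    le : ∀ e → χ F e + χ N e ≤ χ F e · (degreeIn N (end₁ e) + degreeIn N (end₂ e))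
    le e with e ∈? F
    ... | yes e∈F = ≤-trans (dominated-ends (dom e e∈F)) (≤-reflexive (sym (*-identityˡ _)))
    -- Off `F` the right side is 0, and so is the left one since `N ⊆ F`.
    ... | no  e∉F = ≤-reflexive (⟦⟧-no (e ∈? N) (e∉F ∘ N⊆F))

  -- Two-colorable subgraphs from a perfect matching

  union-2-colorable : ∀ {M N} → IsMatching M → IsMatching N → EdgeColorable 2 (M ∪ N)
  union-2-colorable {M} {N} M-matching N-matching = c , proper
    where
    c : Edge → Fin 2
    -- Membership in `M` decides the colour, so an edge of `M ∪ N` with the second colour must lie
    -- in `N`.
    c e = if does (e ∈? M) then zero else suc zero
    ∈N : ∀ {e} → e ∈ M ∪ N → e ∉ M → e ∈ N
    ∈N e∈ e∉M = [ (λ e∈M → contradiction e∈M e∉M) , id ]′ (x∈p∪q⁻ M N e∈)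
    proper : IsProperOn (M ∪ N) c
    proper e f e∈ f∈ e~f ce≡cf with e ∈? M | f ∈? M
    ... | yes e∈M | yes f∈M = M-matching e f e∈M f∈M e~f
    ... | no  e∉M | no  f∉M = N-matching e f (∈N e∈ e∉M) (∈N f∈ f∉M) e~f
    proper e f e∈ f∈ e~f () | yes _ | no _
    proper e f e∈ f∈ e~f () | no _ | yes _

  5V≤6ν₂ : Cubic → HasPerfectMatching G → 5 · |V| ≤ 6 · ν 2 G
  5V≤6ν₂ cubic (M , M-matching , M-covers) with maximalMatchingIn (∁ M)
  ... | N , N-maximal@(N⊆∁M , N-matching , _) = begin
    -- The split balances the coefficients: `2 · |V|` gives `4 · ∣ M ∣`, while `3 · |V| = 2 · |E|`
    -- gives `2 · ∣ M ∣` and, through the complement, `6 · ∣ N ∣`.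
    5 · |V|                              ≡⟨ split |V| ⟩
    2 · |V| + |V| · 3                    ≤⟨ +-mono-≤ (*-monoʳ-≤ 2 V≤2M) (≤-reflexive 3V≡2E) ⟩
    2 · (2 · ∣ M ∣) + 2 · |E|            ≡⟨ cong (λ k → 2 · (2 · ∣ M ∣) + 2 · k) (sym (∣∁H∣+∣H∣ M)) ⟩
    2 · (2 · ∣ M ∣) + 2 · (∣ ∁ M ∣ + ∣ M ∣)
      ≤⟨ +-monoʳ-≤ (2 · (2 · ∣ M ∣)) (*-monoʳ-≤ 2 (+-monoˡ-≤ ∣ M ∣ (maximalMatching-size ∁M≤2 N-maximal))) ⟩
    2 · (2 · ∣ M ∣) + 2 · (3 · ∣ N ∣ + ∣ M ∣)
                                         ≡⟨ collect ∣ M ∣ ∣ N ∣ ⟩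
    6 · (∣ M ∣ + ∣ N ∣)                  ≤⟨ *-monoʳ-≤ 6 (disjoint-∪ M N N⊆∁M) ⟩
    6 · ∣ M ∪ N ∣
      ≤⟨ *-monoʳ-≤ 6 (ν-maximum 2 G (M ∪ N) (union-2-colorable M-matching N-matching)) ⟩
    6 · ν 2 G                            ∎
    where
    open ≤-Reasoning
    split : ∀ n → 5 · n ≡ 2 · n + n · 3
    split = solve-∀
    collect : ∀ m k → 2 · (2 · m) + 2 · (3 · k + m) ≡ 6 · (m + k)
    collect = solve-∀
    M≥1 : ∀ v → 1 ≤ degreeIn M v
    M≥1 v with M-covers v
    ... | e , e∈M , e∋v = degreeIn≥1 e∈M e∋v
    -- At every vertex, `M` takes at least one of the three edges.
    ∁M≤2 : ∀ v → degreeIn (∁ M) v ≤ 2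
    ∁M≤2 v = +-cancelʳ-≤ 1 _ 2 (begin
      degreeIn (∁ M) v + 1               ≤⟨ +-monoʳ-≤ _ (M≥1 v) ⟩
      degreeIn (∁ M) v + degreeIn M v    ≡⟨ degreeIn-∁ M v ⟩
      degree v                           ≡⟨ cubic v ⟩
      3                                  ∎)
    V≤2M : |V| ≤ 2 · ∣ M ∣
    V≤2M = begin
      |V|                          ≡⟨ *-identityʳ |V| ⟨
      |V| · 1                      ≡⟨ sum-const |V| 1 ⟨
      ∑[ v < |V| ] 1               ≤⟨ sum-mono-≤ M≥1 ⟩
      ∑[ v < |V| ] degreeIn M v    ≡⟨ ∑-degreeIn M ⟩
      2 · ∣ M ∣                    ∎
    3V≡2E : |V| · 3 ≡ 2 · |E|
    3V≡2E = begin-equality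
      |V| · 3                                    ≡⟨ sum-const |V| 3 ⟨
      ∑[ v < |V| ] 3                             ≡⟨ sum-cong-≗ (λ v → trans (sym (cubic v)) (degree≡weightedDegree v)) ⟩
      ∑[ v < |V| ] weightedDegree (λ _ → 1) v    ≡⟨ handshake₁ (λ _ → 1) ⟩
      2 · ∑[ e < |E| ] 1                         ≡⟨ cong (2 ·_) (trans (sum-const |E| 1) (*-identityʳ |E|)) ⟩
      2 · |E|                                    ∎

  -- Removing one colour class

  module _ {k : ℕ} (H : Subset |E|) (c : Edge → Fin (2 + k)) (proper : IsProperOn H c) where

    dropColor? : ∀ i → Decidable (λ e → e ∈ H × i ≢ c e)
    dropColor? i e = e ∈? H ×-dec ¬? (i Fin.≟ c e)

    dropColor : Fin (2 + k) → Subset |E|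
    dropColor i = select (dropColor? i)

    -- The colours other than `i` are renumbered by `punchOut`, whose injectivity keeps the
    -- colouring proper.
    dropColor-colorable : ∀ i → EdgeColorable (1 + k) (dropColor i)
    dropColor-colorable i = c′ , proper′
      where
      c′ : Edge → Fin (1 + k)
      c′ e with i Fin.≟ c e
      -- A default value: edges of colour `i` lie outside `dropColor i`.
      ... | yes _   = zero
      ... | no  i≢c = punchOut i≢c
      proper′ : IsProperOn (dropColor i) c′
      proper′ e f e∈ f∈ e~f c′e≡c′f
        with ∈-select⁻ (dropColor? i) e∈ | ∈-select⁻ (dropColor? i) f∈ | i Fin.≟ c e | i Fin.≟ c f
      ... | _ , i≢ce | _ | yes i≡ce | _ = i≢ce i≡ce
      ... | _ | _ , i≢cf | no _ | yes i≡cf = i≢cf i≡cf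
      ... | e∈H , _ | f∈H , _ | no p | no q =
        proper e f e∈H f∈H e~f (punchOut-injective p q c′e≡c′f)

    -- Each edge of `H` either survives or has colour `i`; the sum on the right is the size of that
    -- colour class.
    dropColor-size : ∀ i → ∣ H ∣ ≤ ∣ dropColor i ∣ + ∑[ e < |E| ] (χ H e · ⟦ c e Fin.≟ i ⟧)
    dropColor-size i = begin
      ∣ H ∣                 ≡⟨ ∣p∣≡sum H ⟩
      sum (χ H)             ≤⟨ sum-mono-≤ le ⟩
      ∑[ e < |E| ] (χ (dropColor i) e + χ H e · ⟦ c e Fin.≟ i ⟧)  ≡⟨ ∑-distrib-+ (χ (dropColor i)) _ ⟩
      sum (χ (dropColor i)) + ∑[ e < |E| ] (χ H e · ⟦ c e Fin.≟ i ⟧)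
        ≡⟨ cong (_+ ∑[ e < |E| ] (χ H e · ⟦ c e Fin.≟ i ⟧)) (∣p∣≡sum (dropColor i)) ⟨
      ∣ dropColor i ∣ + ∑[ e < |E| ] (χ H e · ⟦ c e Fin.≟ i ⟧)  ∎
      where
      open ≤-Reasoning
      le : ∀ e → χ H e ≤ χ (dropColor i) e + χ H e · ⟦ c e Fin.≟ i ⟧
      le e with e ∈? H | c e Fin.≟ i
      ... | no  _   | _       = z≤n
      ... | yes _   | yes _   = m≤n+m 1 _
      ... | yes e∈H | no ce≢i =
        m≤n⇒m≤n+o _ (≤-reflexive (sym (⟦⟧-yes (e ∈? dropColor i)
          (∈-select⁺ (dropColor? i) (e∈H , ce≢i ∘ sym)))))

  -- Instead of selecting a smallest class, the bound of `dropColor-size` is summed over all `2 + k`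
  -- colours. The classes partition `H`, so together they contribute `∣ H ∣`, which cancels against
  -- one of the `2 + k` copies on the left.
  ν-ratio : ∀ k → (1 + k) · ν (2 + k) G ≤ (2 + k) · ν (1 + k) G
  ν-ratio k with ν-attained (2 + k) G
  ... | H , (c , proper) , ∣H∣≡ν rewrite sym ∣H∣≡ν =
    +-cancelʳ-≤ ∣ H ∣ _ _ (begin
      (1 + k) · ∣ H ∣ + ∣ H ∣       ≡⟨ +-comm _ ∣ H ∣ ⟩
      (2 + k) · ∣ H ∣               ≡⟨ sum-const (2 + k) ∣ H ∣ ⟨
      ∑[ i < 2 + k ] ∣ H ∣          ≤⟨ sum-mono-≤ (λ i → ≤-trans (dropColor-size H c proper i)
                                         (+-monoˡ-≤ _ (ν-maximum (1 + k) G _ (dropColor-colorable H c proper i)))) ⟩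
      ∑[ i < 2 + k ] (ν (1 + k) G + ∑[ e < |E| ] (χ H e · ⟦ c e Fin.≟ i ⟧))
                                    ≡⟨ ∑-distrib-+ {2 + k} (λ _ → ν (1 + k) G) (λ i → ∑[ e < |E| ] (χ H e · ⟦ c e Fin.≟ i ⟧)) ⟩
      ∑[ i < 2 + k ] ν (1 + k) G + ∑[ i < 2 + k ] ∑[ e < |E| ] (χ H e · ⟦ c e Fin.≟ i ⟧)
                                    ≡⟨ cong₂ _+_ (sum-const (2 + k) (ν (1 + k) G)) classes ⟩
      (2 + k) · ν (1 + k) G + ∣ H ∣ ∎)
    where
    open ≤-Reasoning
    classes : ∑[ i < 2 + k ] ∑[ e < |E| ] (χ H e · ⟦ c e Fin.≟ i ⟧) ≡ ∣ H ∣
    classes = begin-equality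
      ∑[ i < 2 + k ] ∑[ e < |E| ] (χ H e · ⟦ c e Fin.≟ i ⟧)  ≡⟨ ∑-comm {2 + k} (λ i e → χ H e · ⟦ c e Fin.≟ i ⟧) ⟩
      -- Each edge has exactly one colour, so the inner sum collapses to `χ H e`.
      ∑[ e < |E| ] ∑[ i < 2 + k ] (χ H e · ⟦ c e Fin.≟ i ⟧)  ≡⟨ sum-cong-≗ (λ e → sum-δ (λ _ → χ H e) (c e)) ⟩
      sum (χ H)                                             ≡⟨ ∣p∣≡sum H ⟨
      ∣ H ∣                                                 ∎

-- Combining the two bounds and passing to rationals

5[V+2ν₃]≤21ν₂ : (G : Graph) → Graph.Cubic G → HasPerfectMatching G →
  5 · (Graph.|V| G + 2 · ν 3 G) ≤ 21 · ν 2 G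
5[V+2ν₃]≤21ν₂ G cubic pm = begin
  5 · (|V| + 2 · ν 3 G)              ≡⟨ expand |V| (ν 3 G) ⟩
  -- At `k = 1`, `ν-ratio` reads `2 · ν 3 G ≤ 3 · ν 2 G`; with weight 5 it adds 15 to the 6 from the
  -- matching bound.
  5 · |V| + 5 · (2 · ν 3 G)          ≤⟨ +-mono-≤ (5V≤6ν₂ G cubic pm) (*-monoʳ-≤ 5 (ν-ratio G 1)) ⟩
  6 · ν 2 G + 5 · (3 · ν 2 G)        ≡⟨ collect (ν 2 G) ⟩
  21 · ν 2 G                         ∎
  where
  open Graph G using (|V|)
  open ≤-Reasoning
  expand : ∀ a b → 5 · (a + 2 · b) ≡ 5 · a + 5 · (2 · b)
  expand = solve-∀
  collect : ∀ a → 6 · a + 5 · (3 · a) ≡ 21 · a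
  collect = solve-∀

-- Clearing the denominators 21 and 4 turns the claim into `20 · b ≤ 84 · a`, which is four times
-- the hypothesis.
rational-form : ∀ a b → 5 · b ≤ 21 · a → (+ a) / 1 ≥ ((+ 20) / 21) * ((+ b) / 4)
rational-form a b 5b≤21a = ℚ.toℚᵘ-cancel-≤ (begin
  toℚᵘ ((+ 20) / 21 * ((+ b) / 4))            ≃⟨ ℚ.toℚᵘ-homo-* ((+ 20) / 21) ((+ b) / 4) ⟩
  -- Since `b / 4` may reduce, it is replaced by its unreduced form. The second argument of `mkℚᵘ`
  -- is the denominator minus one, so 20, 3 and 0 below encode 21, 4 and 1.
  toℚᵘ ((+ 20) / 21) ℚᵘ.* toℚᵘ ((+ b) / 4)    ≃⟨ ℚᵘ.*-congˡ {toℚᵘ ((+ 20) / 21)} (ℚ.toℚᵘ-fromℚᵘ (mkℚᵘ (+ b) 3)) ⟩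
  mkℚᵘ (+ 20) 20 ℚᵘ.* mkℚᵘ (+ b) 3            ≤⟨ ℚᵘ.*≤* cross-multiplied ⟩
  mkℚᵘ (+ a) 0                                ≃⟨ ℚ.toℚᵘ-fromℚᵘ (mkℚᵘ (+ a) 0) ⟨
  toℚᵘ ((+ a) / 1)                            ∎)
  where
  open ℚᵘ.≤-Reasoning
  lhs : ∀ b → 4 · (5 · b) ≡ 20 · b · 1
  lhs = solve-∀
  rhs : ∀ a → 4 · (21 · a) ≡ a · 84
  rhs = solve-∀
  cross-multiplied : ((+ 20) ℤ.* (+ b)) ℤ.* (+ 1) ℤ.≤ (+ a) ℤ.* (+ 84)
  cross-multiplied
    rewrite sym (ℤ.pos-* 20 b) | sym (ℤ.pos-* (20 · b) 1) | sym (ℤ.pos-* a 84) =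
    ℤ.+≤+ (subst₂ _≤_ (lhs b) (rhs a) (*-monoʳ-≤ 4 5b≤21a))

theorem5 : (G : Graph) → Graph.Cubic G → HasPerfectMatching G →
    (+ ν 2 G) / 1 ≥ ((+ 20) / 21) * ((+ (Graph.|V| G ℕ.+ 2 ℕ.* ν 3 G)) / 4)
theorem5 G cubic pm = rational-form (ν 2 G) (Graph.|V| G + 2 · ν 3 G) (5[V+2ν₃]≤21ν₂ G cubic pm)
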